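{- Exhaustible and searchable sets are closed under the formation of finite products. That is, let $D_1,\dots,D_n$ be domains and $K_j\subseteq D_j$ for $1\le j\le n$. If every $K_j$ is exhaustible then so is $K_1\times\dots\times K_n\subseteq D_1\times\dots\times D_n$, and if every $K_j$ is searchable then so is $K_1\times\dots\times K_n$.
   Context: Domains are the objects of a fixed cartesian closed category of effectively given domains (for instance effectively given Scott domains, i.e. algebraic, bounded complete, directed complete posets), containing the flat domain $\mathcal{B}=\{0,1,\bot\}$ of booleans. $(D\to E)$ denotes the domain of Scott continuous maps ordered pointwise. "Computable" is meant in the standard sense for effectively given domains; computable maps are continuous. A predicate $p\in(D\to\mathcal{B})$ is defined on $K\subseteq D$ if $p(x)\neq\bot$ for all $x\in K$. $K$ is exhaustible if there is a computable $\forall_K:(D\to\mathcal{B})\to\mathcal{B}$ such that for every $p$ defined on $K$, $\forall_K(p)=1$ if $p(x)=1$ for all $x\in K$, and $\forall_K(p)=0$ if $p(x)=0$ for some $x\in K$. $K$ is searchable if there is a computable $\varepsilon_K:(D\to\mathcal{B})\to D$ such that for every $p$ defined on $K$: $\varepsilon_K(p)\in K$, and $p(\varepsilon_K(p))=1$ if $p(x)=1$ for some $x\in K$. -}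

module Defs where

open import Axiom.ExcludedMiddle using (ExcludedMiddle)
open import Data.Empty using (⊥-elim)
open import Data.Fin using (Fin; zero; suc)
open import Data.Nat using (ℕ; zero; suc; _+_)
open import Data.Product using (Σ; ∃; Σ-syntax; ∃-syntax; _×_; _,_; proj₁; proj₂)
open import Data.Unit.Polymorphic using (⊤; tt)
open import Data.Vec using (Vec; []; _∷_; _++_; lookup)
open import Function using (_∘_; _⇔_)
open import Level using (Level; _⊔_; 0ℓ) renaming (suc to lsuc)
open import Relation.Binary using (Poset; _Respects_)
open import Relation.Binary.PropositionalEquality
  using (_≡_; _≢_; refl; subst; isEquivalence)
open import Relation.Nullary using (¬_; Dec; yes; no)
open import Relation.Unary using (Pred)

1ℓ : Level
1ℓ = lsuc 0ℓ

data PrimRec : ℕ → Set where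
  zer  : PrimRec 0
  succ : PrimRec 1
  proj : ∀ {n} → Fin n → PrimRec n
  comp : ∀ {m n} → PrimRec m → Vec (PrimRec n) m → PrimRec n
  rec  : ∀ {n} → PrimRec n → PrimRec (2 + n) → PrimRec (1 + n)

mutual
  eval : ∀ {n} → PrimRec n → Vec ℕ n → ℕ
  eval zer        _             = 0
  eval succ       (x ∷ [])      = suc x
  eval (proj i)   xs            = lookup xs i
  eval (comp f g) xs            = eval f (evals g xs)
  eval (rec f g)  (zero  ∷ xs)  = eval f xs
  eval (rec f g)  (suc x ∷ xs)  = eval g (x ∷ eval (rec f g) (x ∷ xs) ∷ xs)

  evals : ∀ {m n} → Vec (PrimRec n) m → Vec ℕ n → Vec ℕ m
  evals []       xs = []
  evals (g ∷ gs) xs = eval g xs ∷ evals gs xs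

-- A relation is recursively enumerable iff it is the projection of a primitive
-- recursive relation; ws collects the projected-out coordinates.
RE : ∀ {n ℓ} → Pred (Vec ℕ n) ℓ → Set ℓ
RE {n} R =
  Σ[ k ∈ ℕ ] Σ[ f ∈ PrimRec (n + k) ]
    (∀ xs → R xs ⇔ (Σ[ ws ∈ Vec ℕ k ] eval f (xs ++ ws) ≡ 0))

RE₂ : ∀ {ℓ} → (ℕ → ℕ → Set ℓ) → Set ℓ
RE₂ R = RE {2} λ { (m ∷ n ∷ []) → R m n }

module _ (P : Poset 1ℓ 1ℓ 1ℓ) where
  open Poset P

  record IsDirected {i} {I : Set i} (F : I → Carrier) : Set (i ⊔ 1ℓ) where
    field
      inhabitant : I
      bound      : ∀ i j → ∃[ k ] (F i ≤ F k × F j ≤ F k)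

  record IsSup {i} {I : Set i} (F : I → Carrier) (s : Carrier) : Set (i ⊔ 1ℓ) where
    field
      upper : ∀ i → F i ≤ s
      least : ∀ u → (∀ i → F i ≤ u) → s ≤ u

-- Directed families are indexed by types in Set₀, while carriers live in Set₁,
-- so that function spaces are again of type DCPO.  Classically this restricts
-- nothing for the domains below: having a countable basis, each of them is
-- directed complete, and each Scott continuous map between them preserves
-- suprema, for families indexed at any level.
record DCPO : Set (lsuc 1ℓ) where
  field
    poset   : Poset 1ℓ 1ℓ 1ℓ
  open Poset poset public
  field
    ⋁       : {I : Set} (F : I → Carrier) → IsDirected poset F → Carrier
    ⋁-isSup : {I : Set} (F : I → Carrier) (d : IsDirected poset F) →
              IsSup poset F (⋁ F d)

  Directed : ∀ {i} {I : Set i} → (I → Carrier) → Set (i ⊔ 1ℓ)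
  Directed = IsDirected poset

  Sup : ∀ {i} {I : Set i} → (I → Carrier) → Carrier → Set (i ⊔ 1ℓ)
  Sup = IsSup poset

  infix 4 _≪_
  _≪_ : Carrier → Carrier → Set 1ℓ
  x ≪ y = (I : Set) (F : I → Carrier) → Directed F →
          ∀ s → Sup F s → y ≤ s → ∃[ i ] x ≤ F i

open IsDirected
open IsSup

record ScottMap (D E : DCPO) : Set 1ℓ where
  private
    module D = DCPO D
    module E = DCPO E
  field
    fun      : D.Carrier → E.Carrier
    monotone : ∀ {x y} → x D.≤ y → fun x E.≤ fun y
    cont     : {I : Set} (F : I → D.Carrier) → D.Directed F →
               ∀ s → D.Sup F s → E.Sup (fun ∘ F) (fun s)

open ScottMap

infixl 20 _·_
_·_ : ∀ {D E} → ScottMap D E → DCPO.Carrier D → DCPO.Carrier E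
_·_ = fun

mono-directed : ∀ {D E} (f : ScottMap D E) {I : Set} {F : I → DCPO.Carrier D} →
                DCPO.Directed D F → DCPO.Directed E (fun f ∘ F)
mono-directed f d .inhabitant = d .inhabitant
mono-directed f d .bound i j with d .bound i j
... | k , p , q = k , monotone f p , monotone f q

𝟙 : DCPO
𝟙 = record
  { poset = record
    { Carrier = ⊤ ; _≈_ = λ _ _ → ⊤ ; _≤_ = λ _ _ → ⊤
    ; isPartialOrder = record
      { isPreorder = record
        { isEquivalence = record { refl = tt ; sym = λ _ → tt ; trans = λ _ _ → tt }
        ; reflexive = λ _ → tt ; trans = λ _ _ → tt }
      ; antisym = λ _ _ → tt } }
  ; ⋁ = λ _ _ → tt
  ; ⋁-isSup = λ _ _ → record { upper = λ _ → tt ; least = λ _ _ → tt } }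

module _ (D E : DCPO) where
  private
    module D = DCPO D
    module E = DCPO E

  ×-poset : Poset 1ℓ 1ℓ 1ℓ
  ×-poset = record
    { Carrier = D.Carrier × E.Carrier
    ; _≈_ = λ (x , y) (x′ , y′) → x D.≈ x′ × y E.≈ y′
    ; _≤_ = λ (x , y) (x′ , y′) → x D.≤ x′ × y E.≤ y′
    ; isPartialOrder = record
      { isPreorder = record
        { isEquivalence = record
          { refl = D.Eq.refl , E.Eq.refl
          ; sym = λ (p , q) → D.Eq.sym p , E.Eq.sym q
          ; trans = λ (p , q) (p′ , q′) → D.Eq.trans p p′ , E.Eq.trans q q′ }
        ; reflexive = λ (p , q) → D.reflexive p , E.reflexive q
        ; trans = λ (p , q) (p′ , q′) → D.trans p p′ , E.trans q q′ }
      ; antisym = λ (p , q) (p′ , q′) → D.antisym p p′ , E.antisym q q′ } }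

  private
    dir₁ : ∀ {i} {I : Set i} {F : I → D.Carrier × E.Carrier} →
           IsDirected ×-poset F → D.Directed (proj₁ ∘ F)
    dir₁ d .inhabitant = d .inhabitant
    dir₁ d .bound i j with d .bound i j
    ... | k , (p , _) , (q , _) = k , p , q

    dir₂ : ∀ {i} {I : Set i} {F : I → D.Carrier × E.Carrier} →
           IsDirected ×-poset F → E.Directed (proj₂ ∘ F)
    dir₂ d .inhabitant = d .inhabitant
    dir₂ d .bound i j with d .bound i j
    ... | k , (_ , p) , (_ , q) = k , p , q

  infixr 2 _×ᵈ_
  _×ᵈ_ : DCPO
  _×ᵈ_ = record
    { poset = ×-poset
    ; ⋁ = λ F d → D.⋁ (proj₁ ∘ F) (dir₁ d) , E.⋁ (proj₂ ∘ F) (dir₂ d)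
    ; ⋁-isSup = λ F d → let s = D.⋁-isSup (proj₁ ∘ F) (dir₁ d)
                            t = E.⋁-isSup (proj₂ ∘ F) (dir₂ d) in record
      { upper = λ i → upper s i , upper t i
      ; least = λ (u , v) h → least s u (proj₁ ∘ h) , least t v (proj₂ ∘ h) } }

  fst : ScottMap _×ᵈ_ D
  fst .fun = proj₁
  fst .monotone = proj₁
  fst .cont F d (s , t) sup .upper i = proj₁ (upper sup i)
  fst .cont F d (s , t) sup .least u h =
    proj₁ (least sup (u , t) λ i → h i , proj₂ (upper sup i))

  snd : ScottMap _×ᵈ_ E
  snd .fun = proj₂
  snd .monotone = proj₂
  snd .cont F d (s , t) sup .upper i = proj₂ (upper sup i)
  snd .cont F d (s , t) sup .least u h =
    proj₂ (least sup (s , u) λ i → proj₁ (upper sup i) , h i)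

  ⇒-poset : Poset 1ℓ 1ℓ 1ℓ
  ⇒-poset = record
    { Carrier = ScottMap D E
    ; _≈_ = λ f g → ∀ x → f · x E.≈ g · x
    ; _≤_ = λ f g → ∀ x → f · x E.≤ g · x
    ; isPartialOrder = record
      { isPreorder = record
        { isEquivalence = record
          { refl = λ _ → E.Eq.refl
          ; sym = λ p x → E.Eq.sym (p x)
          ; trans = λ p q x → E.Eq.trans (p x) (q x) }
        ; reflexive = λ p x → E.reflexive (p x)
        ; trans = λ p q x → E.trans (p x) (q x) }
      ; antisym = λ p q x → E.antisym (p x) (q x) } }

  private
    dirₓ : ∀ {i} {I : Set i} {F : I → ScottMap D E} → IsDirected ⇒-poset F →
           ∀ x → E.Directed (λ i → F i · x)
    dirₓ d x .inhabitant = d .inhabitant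
    dirₓ d x .bound i j with d .bound i j
    ... | k , p , q = k , p x , q x

    ⋁-map : {I : Set} (F : I → ScottMap D E) → IsDirected ⇒-poset F → ScottMap D E
    ⋁-map F d .fun x = E.⋁ (λ i → F i · x) (dirₓ d x)
    ⋁-map F d .monotone {x} {y} x≤y =
      least (E.⋁-isSup _ (dirₓ d x)) _ λ i →
        E.trans (monotone (F i) x≤y) (upper (E.⋁-isSup _ (dirₓ d y)) i)
    ⋁-map F d .cont G e s sup .upper j = ⋁-map F d .monotone (upper sup j)
    ⋁-map F d .cont G e s sup .least u h =
      least (E.⋁-isSup _ (dirₓ d s)) u λ i →
        least (cont (F i) G e s sup) u λ j →
          E.trans (upper (E.⋁-isSup _ (dirₓ d (G j))) i) (h j)

  infixr 1 _⇒ᵈ_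
  _⇒ᵈ_ : DCPO
  _⇒ᵈ_ = record
    { poset = ⇒-poset
    ; ⋁ = ⋁-map
    ; ⋁-isSup = λ F d → record
      { upper = λ i x → upper (E.⋁-isSup _ (dirₓ d x)) i
      ; least = λ g h x → least (E.⋁-isSup _ (dirₓ d x)) (g · x) λ i → h i x } }

  sup-pointwise : {I : Set} {F : I → ScottMap D E} → IsDirected ⇒-poset F →
                  ∀ {f} → IsSup ⇒-poset F f → ∀ x → E.Sup (λ i → F i · x) (f · x)
  sup-pointwise d sup x .upper i = upper sup i x
  sup-pointwise {F = F} d sup x .least u h =
    E.trans (least sup (⋁-map F d) (λ i y → upper (E.⋁-isSup _ (dirₓ d y)) i) x)
            (least (E.⋁-isSup _ (dirₓ d x)) u h)

module _ (D E : DCPO) where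
  private
    module D = DCPO D
    module E = DCPO E
    module D⇒E = DCPO (D ⇒ᵈ E)

  app : ScottMap ((D ⇒ᵈ E) ×ᵈ D) E
  app .fun (f , x) = f · x
  app .monotone {f , x} {g , y} (f≤g , x≤y) = E.trans (monotone f x≤y) (f≤g y)
  app .cont F d (f , x) sup .upper i = app .monotone {F i} {f , x} (upper sup i)
  app .cont F d (f , x) sup .least u h =
    least (sup-pointwise D E d₁ sup₁ x) u λ i →
      least (cont (proj₁ (F i)) (proj₂ ∘ F) d₂ x sup₂) u λ j →
        let k , (fi≤fk , _) , (_ , xj≤xk) = d .bound i j in
        E.trans (E.trans (fi≤fk _) (monotone (proj₁ (F k)) xj≤xk)) (h k)
    where
    d₁ : D⇒E.Directed (proj₁ ∘ F)
    d₁ = mono-directed (fst (D ⇒ᵈ E) D) d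
    d₂ : D.Directed (proj₂ ∘ F)
    d₂ = mono-directed (snd (D ⇒ᵈ E) D) d
    sup₁ : D⇒E.Sup (proj₁ ∘ F) f
    sup₁ = cont (fst (D ⇒ᵈ E) D) F d (f , x) sup
    sup₂ : D.Sup (proj₂ ∘ F) x
    sup₂ = cont (snd (D ⇒ᵈ E) D) F d (f , x) sup

module _ {C D E : DCPO} where
  private
    module C = DCPO C
    module D = DCPO D
    module E = DCPO E

  pair : ScottMap C D → ScottMap C E → ScottMap C (D ×ᵈ E)
  pair f g .fun x = f · x , g · x
  pair f g .monotone x≤y = monotone f x≤y , monotone g x≤y
  pair f g .cont F d s sup .upper i =
    upper (cont f F d s sup) i , upper (cont g F d s sup) i
  pair f g .cont F d s sup .least (u , v) h =
    least (cont f F d s sup) u (proj₁ ∘ h) , least (cont g F d s sup) v (proj₂ ∘ h)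

  curry : ScottMap (C ×ᵈ D) E → ScottMap C (D ⇒ᵈ E)
  curry f .fun c .fun x = f · (c , x)
  curry f .fun c .monotone x≤y = monotone f (C.refl , x≤y)
  curry f .fun c .cont F d s sup = cont f (λ i → c , F i) d′ (c , s) sup′
    where
    d′ : DCPO.Directed (C ×ᵈ D) (λ i → c , F i)
    d′ .inhabitant = d .inhabitant
    d′ .bound i j with d .bound i j
    ... | k , p , q = k , (C.refl , p) , (C.refl , q)
    sup′ : DCPO.Sup (C ×ᵈ D) (λ i → c , F i) (c , s)
    sup′ .upper i = C.refl , upper sup i
    sup′ .least (u , v) h = proj₁ (h (d .inhabitant)) , least sup v (proj₂ ∘ h)
  curry f .monotone c≤c′ x = monotone f (c≤c′ , D.refl)
  curry f .cont F d s sup .upper i x = monotone f (upper sup i , D.refl)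
  curry f .cont F d s sup .least u h x =
    least (cont f (λ i → F i , x) d′ (s , x) sup′) (u · x) λ i → h i x
    where
    d′ : DCPO.Directed (C ×ᵈ D) (λ i → F i , x)
    d′ .inhabitant = d .inhabitant
    d′ .bound i j with d .bound i j
    ... | k , p , q = k , (p , D.refl) , (q , D.refl)
    sup′ : DCPO.Sup (C ×ᵈ D) (λ i → F i , x) (s , x)
    sup′ .upper i = upper sup i , D.refl
    sup′ .least (v , w) h = least sup v (proj₁ ∘ h) , proj₂ (h (d .inhabitant))

data Bool⊥ : Set₁ where
  0ᵇ 1ᵇ ⊥ᵇ : Bool⊥

data _⊑_ : Bool⊥ → Bool⊥ → Set₁ where
  ⊥⊑   : ∀ {b} → ⊥ᵇ ⊑ b
  refl : ∀ {b} → b ⊑ b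

⊑-poset : Poset 1ℓ 1ℓ 1ℓ
⊑-poset = record
  { Carrier = Bool⊥ ; _≈_ = _≡_ ; _≤_ = _⊑_
  ; isPartialOrder = record
    { isPreorder = record
      { isEquivalence = isEquivalence
      ; reflexive = λ { refl → refl }
      ; trans = λ { ⊥⊑ _ → ⊥⊑ ; refl q → q } }
    ; antisym = λ { ⊥⊑ ⊥⊑ → refl ; ⊥⊑ refl → refl ; refl _ → refl } } }

-- Directed completeness of the three-element flat poset is not constructively
-- provable; this is why the development is relative to excluded middle.
𝔹 : ExcludedMiddle 1ℓ → DCPO
𝔹 em = record { poset = ⊑-poset ; ⋁ = sup ; ⋁-isSup = isSup }
  where
  NonBottom : {I : Set} → (I → Bool⊥) → Set₁
  NonBottom {I} F = Σ[ i ∈ I ] F i ≢ ⊥ᵇ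

  pick : {I : Set} (F : I → Bool⊥) → Dec (NonBottom F) → Bool⊥
  pick F (yes (i , _)) = F i
  pick F (no _)        = ⊥ᵇ

  sup : {I : Set} (F : I → Bool⊥) → IsDirected ⊑-poset F → Bool⊥
  sup F _ = pick F em

  maximal : ∀ {a b} → a ⊑ b → a ≢ ⊥ᵇ → b ≡ a
  maximal ⊥⊑   a≢⊥ = ⊥-elim (a≢⊥ refl)
  maximal refl _   = refl

  below-⊥ : ∀ {b} → ¬ (b ≢ ⊥ᵇ) → b ⊑ ⊥ᵇ
  below-⊥ {0ᵇ} ¬¬p = ⊥-elim (¬¬p λ ())
  below-⊥ {1ᵇ} ¬¬p = ⊥-elim (¬¬p λ ())
  below-⊥ {⊥ᵇ} _   = refl

  pick-isSup : {I : Set} (F : I → Bool⊥) → IsDirected ⊑-poset F →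
               (dec : Dec (NonBottom F)) → IsSup ⊑-poset F (pick F dec)
  pick-isSup F d (yes (i , Fi≢⊥)) .upper j with d .bound i j
  ... | k , Fi⊑Fk , Fj⊑Fk = subst (F j ⊑_) (maximal Fi⊑Fk Fi≢⊥) Fj⊑Fk
  pick-isSup F d (yes (i , _)) .least u h = h i
  pick-isSup F d (no ¬p) .upper j = below-⊥ λ Fj≢⊥ → ¬p (j , Fj≢⊥)
  pick-isSup F d (no ¬p) .least u h = ⊥⊑

  isSup : {I : Set} (F : I → Bool⊥) (d : IsDirected ⊑-poset F) →
          IsSup ⊑-poset F (sup F d)
  isSup F d = pick-isSup F d em

-- Continuous dcpo with an enumerated basis on which ≪ is recursively
-- enumerable.  For algebraic domains with an enumeration of the compact
-- elements, x ≪ y between basis elements is x ≤ y.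
record EffectivePresentation (D : DCPO) : Set 1ℓ where
  open DCPO D
  field
    basis    : ℕ → Carrier
    directed : ∀ x → Directed {I = ∃[ k ] basis k ≪ x} (basis ∘ proj₁)
    approx   : ∀ x → Sup      {I = ∃[ k ] basis k ≪ x} (basis ∘ proj₁) x
    ≪-re     : RE₂ λ m n → basis m ≪ basis n

IsComputable : ∀ {D E} → EffectivePresentation D → EffectivePresentation E →
               ScottMap D E → Set 1ℓ
IsComputable {E = E} P Q f = RE₂ λ m n → Q.basis n ≪ f · P.basis m
  where
  module P = EffectivePresentation P
  module Q = EffectivePresentation Q
  open DCPO E using (_≪_)

-- A cartesian closed category containing the flat booleans: objects are dcpos
-- with effective data of some chosen kind (Effective), morphisms are all the
-- computable maps between them.  Products and exponentials are the products
-- and Scott function spaces of dcpos; their effective data is determined up to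
-- computable isomorphism by the universal properties.
record EffectiveCCC (em : ExcludedMiddle 1ℓ) (o : Level) : Set (lsuc (1ℓ ⊔ o)) where
  field
    Effective    : DCPO → Set o
    presentation : ∀ {D} → Effective D → EffectivePresentation D

  Domain : Set (lsuc 1ℓ ⊔ o)
  Domain = Σ DCPO Effective

  ∣_∣ : Domain → Set 1ℓ
  ∣ D ∣ = DCPO.Carrier (proj₁ D)

  Map : Domain → Domain → Set 1ℓ
  Map D E = ScottMap (proj₁ D) (proj₁ E)

  Computable : ∀ D E → Map D E → Set 1ℓ
  Computable D E = IsComputable (presentation (proj₂ D)) (presentation (proj₂ E))

  field
    effective-𝟙 : Effective 𝟙
    effective-𝔹 : Effective (𝔹 em)
    effective-× : ∀ {D E} → Effective D → Effective E → Effective (D ×ᵈ E)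
    effective-⇒ : ∀ {D E} → Effective D → Effective E → Effective (D ⇒ᵈ E)

  One : Domain
  One = 𝟙 , effective-𝟙

  Bool : Domain
  Bool = 𝔹 em , effective-𝔹

  infixr 2 _⊗_
  _⊗_ : Domain → Domain → Domain
  D ⊗ E = (proj₁ D ×ᵈ proj₁ E) , effective-× (proj₂ D) (proj₂ E)

  infixr 1 _⟶_
  _⟶_ : Domain → Domain → Domain
  D ⟶ E = (proj₁ D ⇒ᵈ proj₁ E) , effective-⇒ (proj₂ D) (proj₂ E)

  field
    fst-computable   : ∀ D E → Computable (D ⊗ E) D (fst (proj₁ D) (proj₁ E))
    snd-computable   : ∀ D E → Computable (D ⊗ E) E (snd (proj₁ D) (proj₁ E))
    pair-computable  : ∀ C D E (f : Map C D) (g : Map C E) →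
                       Computable C D f → Computable C E g →
                       Computable C (D ⊗ E) (pair f g)
    app-computable   : ∀ D E → Computable ((D ⟶ E) ⊗ D) E (app (proj₁ D) (proj₁ E))
    curry-computable : ∀ C D E (f : Map (C ⊗ D) E) →
                       Computable (C ⊗ D) E f → Computable C (D ⟶ E) (curry f)

  record Subset (D : Domain) : Set (lsuc 1ℓ) where
    field
      member  : Pred ∣ D ∣ 1ℓ
      respect : member Respects (DCPO._≈_ (proj₁ D))

  infix 4 _∈_
  _∈_ : ∀ {D} → ∣ D ∣ → Subset D → Set 1ℓ
  x ∈ K = Subset.member K x

  DefinedOn : ∀ D → Map D Bool → Subset D → Set 1ℓ
  DefinedOn D p K = ∀ x → x ∈ K → p · x ≢ ⊥ᵇ

  Exhaustible : ∀ D → Subset D → Set 1ℓ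
  Exhaustible D K =
    Σ[ A ∈ Map (D ⟶ Bool) Bool ] Computable (D ⟶ Bool) Bool A ×
      (∀ p → DefinedOn D p K →
        ((∀ x → x ∈ K → p · x ≡ 1ᵇ) → A · p ≡ 1ᵇ) ×
        ((∃[ x ] x ∈ K × p · x ≡ 0ᵇ) → A · p ≡ 0ᵇ))

  Searchable : ∀ D → Subset D → Set 1ℓ
  Searchable D K =
    Σ[ ε ∈ Map (D ⟶ Bool) D ] Computable (D ⟶ Bool) D ε ×
      (∀ p → DefinedOn D p K →
        (ε · p ∈ K) ×
        ((∃[ x ] x ∈ K × p · x ≡ 1ᵇ) → p · (ε · p) ≡ 1ᵇ))

  full : Subset One
  full = record { member = λ _ → ⊤ ; respect = λ _ _ → tt }

  _⊠_ : ∀ {D E} → Subset D → Subset E → Subset (D ⊗ E)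
  K ⊠ L = record
    { member  = λ (x , y) → x ∈ K × y ∈ L
    ; respect = λ (p , q) (x∈K , y∈L) →
        Subset.respect K p x∈K , Subset.respect L q y∈L }

  ∏ : ∀ {n} → (Fin n → Domain) → Domain
  ∏ {zero}        D = One
  ∏ {suc zero}    D = D zero
  ∏ {suc (suc n)} D = D zero ⊗ ∏ (D ∘ suc)

  ∏ˢ : ∀ {n} {D : Fin n → Domain} → (∀ j → Subset (D j)) → Subset (∏ D)
  ∏ˢ {zero}        K = full
  ∏ˢ {suc zero}    K = K zero
  ∏ˢ {suc (suc n)} K = K zero ⊠ ∏ˢ (K ∘ suc)

{-# OPTIONS --safe #-}

-- For a predicate p on D × E, with sections pₓ(y) = p(x , y):
--   ∀(p) = ∀_K (λ x → ∀_L pₓ)   quantifies over K × L, and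
--   ε(p) = (x₀ , ε_L pₓ₀), where x₀ = ε_K (λ x → p (x , ε_L pₓ)), searches K × L.
-- Both are terms of the cartesian closed structure, so computability reduces to
-- closure of computable maps under composition.  This holds because
-- c ≪ g (f x) iff c ≪ g b for some basis element b ≪ f x, which is again a
-- recursively enumerable condition.
module Submission where

open import Axiom.ExcludedMiddle using (ExcludedMiddle)
open import Data.Empty using (⊥-elim)
open import Data.Fin using (Fin; zero; suc; _↑ˡ_; _↑ʳ_)
open import Data.Nat using (ℕ; zero; suc; _+_)
open import Data.Nat.Properties using (m+n≡0⇒m≡0; m+n≡0⇒n≡0)
open import Data.Product using (_×_; _,_; proj₁; proj₂; Σ-syntax; ∃-syntax)
open import Data.Unit.Polymorphic using (tt)
open import Data.Vec using (Vec; []; _∷_; _++_; lookup; splitAt; tabulate)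
open import Data.Vec.Properties
  using (lookup-++ˡ; lookup-++ʳ; tabulate-cong; tabulate∘lookup)
open import Function using (_∘_; _⇔_; mk⇔; Equivalence)
open import Level using (Level)
open import Relation.Binary.PropositionalEquality
  using (_≡_; _≢_; refl; sym; trans; cong; cong₂)
open import Relation.Nullary using (Dec; yes; no)
open import Relation.Nullary.Decidable using (True; toWitness; fromWitness)
open import Relation.Unary using (Pred)
open import Defs

open IsDirected
open IsSup
open ScottMap

-- Recursively enumerable relations

-- Substituting projections renames variables: `comp f (projections ρ)` reads argument `i` of `f`
-- from position `ρ i`.
projections : ∀ {m n} → (Fin m → Fin n) → Vec (PrimRec n) m
projections ρ = tabulate (proj ∘ ρ)

evals-projections : ∀ {m n} (ρ : Fin m → Fin n) xs →
                    evals (projections ρ) xs ≡ tabulate (lookup xs ∘ ρ)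
evals-projections {zero}  ρ xs = refl
evals-projections {suc m} ρ xs = cong (lookup xs (ρ zero) ∷_) (evals-projections (ρ ∘ suc) xs)

-- A sum of naturals vanishes exactly when both summands do, so addition merges the two equations
-- expressing a conjunction into one.
plus : PrimRec 2
plus = rec (proj zero) (comp succ (proj (suc zero) ∷ []))

eval-plus : ∀ x y → eval plus (x ∷ y ∷ []) ≡ x + y
eval-plus zero    y = refl
eval-plus (suc x) y = cong suc (eval-plus x y)

RE₂-universal : ∀ {ℓ} {R : ℕ → ℕ → Set ℓ} → (∀ m n → R m n) → RE₂ R
RE₂-universal R-holds =
  0 , comp zer [] , λ { (m ∷ n ∷ []) → mk⇔ (λ _ → [] , refl) (λ _ → R-holds m n) }

-- Computability of the identity concerns `≪` on the basis with its two arguments swapped.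
RE₂-flip : ∀ {ℓ} {R : ℕ → ℕ → Set ℓ} → RE₂ R → RE₂ (λ m n → R n m)
RE₂-flip {R = R} (k , f , f-enum) = k , comp f (projections ρ) , enum
  where
  ρ : Fin (2 + k) → Fin (2 + k)
  ρ zero          = suc zero
  ρ (suc zero)    = zero
  ρ (suc (suc i)) = suc (suc i)

  args : ∀ m n ws → evals (projections ρ) (m ∷ n ∷ ws) ≡ n ∷ m ∷ ws
  args m n ws = trans (evals-projections ρ (m ∷ n ∷ ws))
                      (cong (λ vs → n ∷ m ∷ vs) (tabulate∘lookup ws))

  enum : ∀ xs → _
  enum (m ∷ n ∷ []) = mk⇔
    (λ r → let ws , e = to r in ws , trans (cong (eval f) (args m n ws)) e)
    (λ (ws , e) → from (ws , trans (sym (cong (eval f) (args m n ws))) e))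
    where open Equivalence (f-enum (n ∷ m ∷ []))

-- The intermediate `i` becomes one more projected-out coordinate, in front of the witnesses for `R`
-- and `S`.
RE₂-compose : ∀ {a b} {R : ℕ → ℕ → Set a} {S : ℕ → ℕ → Set b} →
              RE₂ R → RE₂ S → RE₂ (λ m n → ∃[ i ] (R m i × S i n))
RE₂-compose {R = R} {S} (k , f , f-enum) (l , g , g-enum) =
  1 + (k + l) , comp plus (f′ ∷ g′ ∷ []) , enum
  where
  -- ρ and σ select m ∷ i ∷ vs and i ∷ n ∷ ws from m ∷ n ∷ i ∷ vs ++ ws.
  ρ : Fin (2 + k) → Fin (3 + (k + l))
  ρ zero          = zero
  ρ (suc zero)    = suc (suc zero)
  ρ (suc (suc j)) = suc (suc (suc (j ↑ˡ l)))

  σ : Fin (2 + l) → Fin (3 + (k + l))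
  σ zero          = suc (suc zero)
  σ (suc zero)    = suc zero
  σ (suc (suc j)) = suc (suc (suc (k ↑ʳ j)))

  f′ g′ : PrimRec (3 + (k + l))
  f′ = comp f (projections ρ)
  g′ = comp g (projections σ)

  module _ (m n i : ℕ) (vs : Vec ℕ k) (ws : Vec ℕ l) where
    env : Vec ℕ (3 + (k + l))
    env = m ∷ n ∷ i ∷ vs ++ ws

    eval-f′ : eval f′ env ≡ eval f (m ∷ i ∷ vs)
    eval-f′ = cong (eval f) (trans (evals-projections ρ env)
      (cong (λ us → m ∷ i ∷ us)
        (trans (tabulate-cong (lookup-++ˡ vs ws)) (tabulate∘lookup vs))))

    eval-g′ : eval g′ env ≡ eval g (i ∷ n ∷ ws)
    eval-g′ = cong (eval g) (trans (evals-projections σ env)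
      (cong (λ us → i ∷ n ∷ us)
        (trans (tabulate-cong (lookup-++ʳ vs ws)) (tabulate∘lookup ws))))

    eval-sum : eval (comp plus (f′ ∷ g′ ∷ [])) env ≡
               eval f (m ∷ i ∷ vs) + eval g (i ∷ n ∷ ws)
    eval-sum = trans (eval-plus (eval f′ env) (eval g′ env)) (cong₂ _+_ eval-f′ eval-g′)

  enum : ∀ xs → _
  enum (m ∷ n ∷ []) = mk⇔ to from
    where
    module F i = Equivalence (f-enum (m ∷ i ∷ []))
    module G i = Equivalence (g-enum (i ∷ n ∷ []))

    to : ∃[ i ] (R m i × S i n) →
         Σ[ us ∈ Vec ℕ (1 + (k + l)) ] eval (comp plus (f′ ∷ g′ ∷ [])) (m ∷ n ∷ us) ≡ 0
    to (i , r , s) =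
      let vs , p = F.to i r
          ws , q = G.to i s
      in i ∷ vs ++ ws , trans (eval-sum m n i vs ws) (cong₂ _+_ p q)

    from : Σ[ us ∈ Vec ℕ (1 + (k + l)) ] eval (comp plus (f′ ∷ g′ ∷ [])) (m ∷ n ∷ us) ≡ 0 →
           ∃[ i ] (R m i × S i n)
    -- Every tail splits as `vs ++ ws`, so `eval-sum` covers arbitrary witnesses, not only those
    -- produced by `to`.
    from (i ∷ us , e) with splitAt k us
    ... | vs , ws , refl =
      i , F.from i (vs , m+n≡0⇒m≡0 _ sum≡0) ,
          G.from i (ws , m+n≡0⇒n≡0 (eval f (m ∷ i ∷ vs)) sum≡0)
      where
      sum≡0 : eval f (m ∷ i ∷ vs) + eval g (i ∷ n ∷ ws) ≡ 0
      sum≡0 = trans (sym (eval-sum m n i vs ws)) e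

RE₂-resp-⇔ : ∀ {a b} {R : ℕ → ℕ → Set a} {S : ℕ → ℕ → Set b} →
             (∀ m n → R m n ⇔ S m n) → RE₂ R → RE₂ S
RE₂-resp-⇔ R⇔S (k , f , f-enum) = k , f , λ { (m ∷ n ∷ []) →
  let module E = Equivalence (R⇔S m n)
      module F = Equivalence (f-enum (m ∷ n ∷ []))
  in mk⇔ (F.to ∘ E.from) (E.to ∘ F.from) }

-- Computability of identities, composites and maps into 𝟙

module _ (D : DCPO) where
  open DCPO D

  constant-directed : ∀ y → Directed {I = Fin 1} (λ _ → y)
  constant-directed y .inhabitant = zero
  constant-directed y .bound _ _  = zero , DCPO.refl D , DCPO.refl D

  constant-sup : ∀ y → Sup {I = Fin 1} (λ _ → y) y
  constant-sup y .upper _   = DCPO.refl D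
  constant-sup y .least u h = h zero

  -- Test `≪` on the constant family at `y`; its index `Fin 1` lies in `Set`, as `≪` demands.
  ≪⇒≤ : ∀ {x y} → x ≪ y → x ≤ y
  ≪⇒≤ {y = y} x≪y =
    proj₂ (x≪y (Fin 1) (λ _ → y) (constant-directed y) y (constant-sup y) (DCPO.refl D))

  ≪-≤-trans : ∀ {x y z} → x ≪ y → y ≤ z → x ≪ z
  ≪-≤-trans x≪y y≤z I F d s sup z≤s = x≪y I F d s sup (DCPO.trans D y≤z z≤s)

  ≤-≪-trans : ∀ {x y z} → x ≤ y → y ≪ z → x ≪ z
  ≤-≪-trans x≤y y≪z I F d s sup z≤s =
    let i , y≤Fi = y≪z I F d s sup z≤s in i , DCPO.trans D x≤y y≤Fi

-- Approximating families are indexed by types in Set₁, whereas ≪ and Scott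
-- continuity only speak of families indexed in Set; excluded middle bridges the gap.
module _ (em : ExcludedMiddle 1ℓ) where

  -- `True` of a decision of `A k` lies in `Set` and is inhabited exactly when `A k` is.
  Resized : Pred ℕ 1ℓ → Set
  Resized A = Σ[ k ∈ ℕ ] True (em {A k})

  module _ (P : DCPO) {A : Pred ℕ 1ℓ} {b : ℕ → DCPO.Carrier P} where
    open DCPO P

    resize-directed : Directed {I = ∃[ k ] A k} (b ∘ proj₁) →
                      Directed {I = Resized A} (b ∘ proj₁)
    resize-directed d .inhabitant = let k , a = d .inhabitant in k , fromWitness a
    resize-directed d .bound (i , p) (j , q) =
      let (k , a) , i≤k , j≤k = d .bound (i , toWitness p) (j , toWitness q)
      in (k , fromWitness a) , i≤k , j≤k

    resize-sup : ∀ {s} → Sup {I = ∃[ k ] A k} (b ∘ proj₁) s →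
                 Sup {I = Resized A} (b ∘ proj₁) s
    resize-sup sup .upper (k , p)  = upper sup (k , toWitness p)
    resize-sup sup .least u h = least sup u λ (k , a) → h (k , fromWitness a)

idˢ : ∀ {D} → ScottMap D D
idˢ .fun x            = x
idˢ .monotone p       = p
idˢ .cont F d s sup   = sup

infixr 9 _∘ˢ_
_∘ˢ_ : ∀ {C D E} → ScottMap D E → ScottMap C D → ScottMap C E
(g ∘ˢ f) .fun x = g · (f · x)
(g ∘ˢ f) .monotone = monotone g ∘ monotone f
(g ∘ˢ f) .cont F d s sup =
  cont g (fun f ∘ F) (mono-directed f d) (f · s) (cont f F d s sup)

id-computable : ∀ {D} (P : EffectivePresentation D) → IsComputable P P idˢ
id-computable P = RE₂-flip (EffectivePresentation.≪-re P)

module _ (em : ExcludedMiddle 1ℓ) {D E : DCPO}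
         (Q : EffectivePresentation D) (R : EffectivePresentation E) (g : ScottMap D E) where
  private
    module Q = EffectivePresentation Q
    module R = EffectivePresentation R
    module D = DCPO D
    module E = DCPO E

  module _ (y : D.Carrier) where
    Below : Pred ℕ 1ℓ
    Below n = ∃[ k ] (Q.basis k D.≪ y × R.basis n E.≪ g · Q.basis k)

    -- Bounds are taken twice: first `k″` above `k` and `k′` in `D`; then, since monotonicity makes
    -- `n` and `n′` approximate `g · Q.basis k″`, a bound among its approximants.
    below-directed : E.Directed {I = ∃[ n ] Below n} (R.basis ∘ proj₁)
    below-directed .inhabitant =
      let k , k≪y  = Q.directed y .inhabitant
          n , n≪gk = R.directed (g · Q.basis k) .inhabitant
      in n , k , k≪y , n≪gk
    below-directed .bound (n , k , k≪y , n≪gk) (n′ , k′ , k′≪y , n′≪gk′) =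
      let (k″ , k″≪y) , k≤k″ , k′≤k″ = Q.directed y .bound (k , k≪y) (k′ , k′≪y)
          (n″ , n″≪gk″) , n≤n″ , n′≤n″ = R.directed (g · Q.basis k″) .bound
            (n  , ≪-≤-trans E n≪gk (monotone g k≤k″))
            (n′ , ≪-≤-trans E n′≪gk′ (monotone g k′≤k″))
      in (n″ , k″ , k″≪y , n″≪gk″) , n≤n″ , n′≤n″

    -- An iterated supremum: by continuity `g · y` is the supremum of the `g · Q.basis k`, each of
    -- which is the supremum of its own approximants.
    below-sup : E.Sup {I = ∃[ n ] Below n} (R.basis ∘ proj₁) (g · y)
    below-sup .upper (n , k , k≪y , n≪gk) =
      E.trans (≪⇒≤ E n≪gk) (monotone g (≪⇒≤ D k≪y))
    below-sup .least u h =
      least (cont g (Q.basis ∘ proj₁) (resize-directed em D (Q.directed y)) y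
                  (resize-sup em D (Q.approx y))) u λ (k , k≪y) →
        least (R.approx (g · Q.basis k)) u λ (n , n≪gk) →
          h (n , k , toWitness k≪y , n≪gk)

    below⇒≪ : ∀ {n} → Below n → R.basis n E.≪ g · y
    below⇒≪ (k , k≪y , n≪gk) = ≪-≤-trans E n≪gk (monotone g (≪⇒≤ D k≪y))

    -- By definition of `≪`, some member `j` of the directed family with supremum `g · y` lies above
    -- `n`, and `Below` is downward closed.
    ≪⇒below : ∀ {n} → R.basis n E.≪ g · y → Below n
    ≪⇒below n≪gy =
      let (j , b) , n≤j = n≪gy (Resized em Below) (R.basis ∘ proj₁)
                            (resize-directed em E below-directed) (g · y)
                            (resize-sup em E below-sup) E.refl
          k , k≪y , j≪gk = toWitness b
      in k , k≪y , ≤-≪-trans E n≤j j≪gk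

  -- At `y = f · basis m`, `Below` is literally the relational composite of the two given enumerable
  -- relations.
  ∘-computable : ∀ {C} (P : EffectivePresentation C) (f : ScottMap C D) →
                 IsComputable Q R g → IsComputable P Q f → IsComputable P R (g ∘ˢ f)
  ∘-computable P f g-comp f-comp =
    RE₂-resp-⇔ (λ m n → let y = f · EffectivePresentation.basis P m in
                            mk⇔ (below⇒≪ y) (≪⇒below y))
               (RE₂-compose f-comp g-comp)

! : ∀ {C} → ScottMap C 𝟙
! .fun _ = tt
! .monotone _ = tt
! .cont _ _ _ _ = record { upper = λ _ → tt ; least = λ _ _ → tt }

-- In `𝟙` every element is way below every other, because directed families are inhabited.
!-computable : ∀ {C} (P : EffectivePresentation C) (Q : EffectivePresentation 𝟙) →
               IsComputable P Q !
!-computable P Q = RE₂-universal λ _ _ _ _ d _ _ _ → d .inhabitant , tt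

module _ {o : Level} (em : ExcludedMiddle 1ℓ) (𝒞 : EffectiveCCC em o) where
  open EffectiveCCC 𝒞

  -- The cartesian closed structure on computable maps.

  infix 0 _⇝_
  -- Bundling a map with its computability proof makes every term built from the combinators
  -- computable by construction.
  record _⇝_ (C D : Domain) : Set 1ℓ where
    constructor computes
    field
      map        : Map C D
      computable : Computable C D map
  open _⇝_

  infixr 9 _⊙_
  infixr 5 ⟨_,_⟩

  idᶜ : ∀ {D} → D ⇝ D
  idᶜ {D} = computes idˢ (id-computable (presentation (proj₂ D)))

  _⊙_ : ∀ {C D E} → D ⇝ E → C ⇝ D → C ⇝ E
  _⊙_ {C} {D} {E} (computes g g-comp) (computes f f-comp) =
    computes (g ∘ˢ f) (∘-computable em (presentation (proj₂ D)) (presentation (proj₂ E)) g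
                                    (presentation (proj₂ C)) f g-comp f-comp)

  !ᶜ : ∀ {C} → C ⇝ One
  !ᶜ {C} = computes ! (!-computable (presentation (proj₂ C)) (presentation effective-𝟙))

  π₁ : ∀ D E → D ⊗ E ⇝ D
  π₁ D E = computes (fst (proj₁ D) (proj₁ E)) (fst-computable D E)

  π₂ : ∀ D E → D ⊗ E ⇝ E
  π₂ D E = computes (snd (proj₁ D) (proj₁ E)) (snd-computable D E)

  ⟨_,_⟩ : ∀ {C D E} → C ⇝ D → C ⇝ E → C ⇝ D ⊗ E
  ⟨_,_⟩ {C} {D} {E} f g =
    computes (pair (map f) (map g))
             (pair-computable C D E (map f) (map g) (computable f) (computable g))

  apply : ∀ D E → (D ⟶ E) ⊗ D ⇝ E
  apply D E = computes (app (proj₁ D) (proj₁ E)) (app-computable D E)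

  Λ : ∀ {C D E} → C ⊗ D ⇝ E → C ⇝ (D ⟶ E)
  Λ {C} {D} {E} f = computes (curry (map f)) (curry-computable C D E (map f) (computable f))

  section : ∀ D E → (D ⊗ E ⟶ Bool) ⊗ D ⇝ (E ⟶ Bool)
  section D E = Λ {PD} {E} {Bool}
    -- In the context `((p , x) , y)` this is `p` applied to `(x , y)`.
    (apply (D ⊗ E) Bool ⊙ ⟨ π₁ P D ⊙ π₁ PD E , ⟨ π₂ P D ⊙ π₁ PD E , π₂ PD E ⟩ ⟩)
    where
    P PD : Domain
    P  = D ⊗ E ⟶ Bool
    PD = P ⊗ D

  -- Exhaustible and searchable sets, and definedness of quantifiers.

  exhaustible : ∀ {D} (K : Subset D) (A : (D ⟶ Bool) ⇝ Bool) →
    (∀ p → DefinedOn D p K → (∀ x → _∈_ {D} x K → p · x ≡ 1ᵇ) → map A · p ≡ 1ᵇ) →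
    (∀ p → DefinedOn D p K → (∃[ x ] _∈_ {D} x K × p · x ≡ 0ᵇ) → map A · p ≡ 0ᵇ) →
    Exhaustible D K
  exhaustible K A if-true if-false =
    map A , computable A , λ p p-def → if-true p p-def , if-false p p-def

  searchable : ∀ {D} (K : Subset D) (ε : (D ⟶ Bool) ⇝ D) →
    (∀ p → DefinedOn D p K → _∈_ {D} (map ε · p) K) →
    (∀ p → DefinedOn D p K → (∃[ x ] _∈_ {D} x K × p · x ≡ 1ᵇ) → p · (map ε · p) ≡ 1ᵇ) →
    Searchable D K
  searchable K ε found satisfied =
    map ε , computable ε , λ p p-def → found p p-def , satisfied p p-def

  ≢⊥∧≢0⇒≡1 : ∀ {b} → b ≢ ⊥ᵇ → b ≢ 0ᵇ → b ≡ 1ᵇ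
  ≢⊥∧≢0⇒≡1 {0ᵇ} _   b≢0 = ⊥-elim (b≢0 refl)
  ≢⊥∧≢0⇒≡1 {1ᵇ} _   _   = refl
  ≢⊥∧≢0⇒≡1 {⊥ᵇ} b≢⊥ _   = ⊥-elim (b≢⊥ refl)

  ≡⇒≢⊥ : ∀ {b c} → c ≢ ⊥ᵇ → b ≡ c → b ≢ ⊥ᵇ
  ≡⇒≢⊥ c≢⊥ refl = c≢⊥

  -- Needed so that a quantifier can itself serve as a defined predicate. Either a counterexample
  -- exists, or definedness forces `p` to be `1ᵇ` on `K`; each case fixes the value of `A`.
  exhaustible-⇒-≢⊥ : ∀ {D} (K : Subset D) ((A , _) : Exhaustible D K) p →
                     DefinedOn D p K → A · p ≢ ⊥ᵇ
  exhaustible-⇒-≢⊥ {D} K (A , _ , spec) p p-def =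
    decide (em {∃[ x ] _∈_ {D} x K × p · x ≡ 0ᵇ})
    where
    decide : Dec (∃[ x ] _∈_ {D} x K × p · x ≡ 0ᵇ) → A · p ≢ ⊥ᵇ
    decide (yes refuted)  = ≡⇒≢⊥ (λ ()) (proj₂ (spec p p-def) refuted)
    decide (no unrefuted) = ≡⇒≢⊥ (λ ()) (proj₁ (spec p p-def) λ x x∈K →
      ≢⊥∧≢0⇒≡1 (p-def x x∈K) λ px≡0 → unrefuted (x , x∈K , px≡0))

  -- The empty product.

  full-exhaustible : Exhaustible One full
  full-exhaustible =
    exhaustible full at-tt (λ _ _ p≡1 → p≡1 tt tt) (λ _ _ (_ , _ , p≡0) → p≡0)
    where
    at-tt : (One ⟶ Bool) ⇝ Bool
    at-tt = apply One Bool ⊙ ⟨ idᶜ , !ᶜ ⟩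

  full-searchable : Searchable One full
  full-searchable = searchable full !ᶜ (λ _ _ → tt) (λ _ _ (_ , _ , p≡1) → p≡1)

  -- Binary products.

  module _ {D E : Domain} (K : Subset D) (L : Subset E) (p : Map (D ⊗ E) Bool) where

    -- `slice x · y` reduces to `p · (x , y)`, so facts about `p` transfer without rewriting.
    slice : ∣ D ∣ → Map E Bool
    slice x = map (section D E) · (p , x)

    slice-defined : DefinedOn (D ⊗ E) p (K ⊠ L) →
                    ∀ x → _∈_ {D} x K → DefinedOn E (slice x) L
    slice-defined p-def x x∈K y y∈L = p-def (x , y) (x∈K , y∈L)

  ⊠-exhaustible : ∀ {D E} (K : Subset D) (L : Subset E) →
                  Exhaustible D K → Exhaustible E L → Exhaustible (D ⊗ E) (K ⊠ L)
  ⊠-exhaustible {D} {E} K L (A , A-comp , A-spec) exL@(B , B-comp , B-spec) =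
    exhaustible (K ⊠ L) quantify if-true if-false
    where
    inner : (D ⊗ E ⟶ Bool) ⇝ (D ⟶ Bool)
    inner = Λ {D ⊗ E ⟶ Bool} {D} {Bool} (computes B B-comp ⊙ section D E)

    quantify : (D ⊗ E ⟶ Bool) ⇝ Bool
    quantify = computes A A-comp ⊙ inner

    module _ (p : Map (D ⊗ E) Bool) (p-def : DefinedOn (D ⊗ E) p (K ⊠ L)) where
      q : Map D Bool
      q = map inner · p

      p-defₓ : ∀ x → _∈_ {D} x K → DefinedOn E (slice K L p x) L
      p-defₓ = slice-defined K L p p-def

      q-def : DefinedOn D q K
      -- `q · x` reduces to `B` applied to the slice at `x`.
      q-def x x∈K = exhaustible-⇒-≢⊥ L exL (slice K L p x) (p-defₓ x x∈K)

      if-true : (∀ z → _∈_ {D ⊗ E} z (K ⊠ L) → p · z ≡ 1ᵇ) → map quantify · p ≡ 1ᵇ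
      if-true p≡1 = proj₁ (A-spec q q-def) λ x x∈K →
        proj₁ (B-spec (slice K L p x) (p-defₓ x x∈K)) λ y y∈L → p≡1 (x , y) (x∈K , y∈L)

      if-false : (∃[ z ] _∈_ {D ⊗ E} z (K ⊠ L) × p · z ≡ 0ᵇ) → map quantify · p ≡ 0ᵇ
      -- The point `y` refutes the slice at `x`, hence `x` refutes `q`.
      if-false ((x , y) , (x∈K , y∈L) , p≡0) = proj₂ (A-spec q q-def)
        (x , x∈K , proj₂ (B-spec (slice K L p x) (p-defₓ x x∈K)) (y , y∈L , p≡0))

  ⊠-searchable : ∀ {D E} (K : Subset D) (L : Subset E) →
                 Searchable D K → Searchable E L → Searchable (D ⊗ E) (K ⊠ L)
  ⊠-searchable {D} {E} K L (δ , δ-comp , δ-spec) (ε , ε-comp , ε-spec) =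
    searchable (K ⊠ L) search found satisfied
    where
    P : Domain
    P = D ⊗ E ⟶ Bool

    second : P ⊗ D ⇝ E
    second = computes ε ε-comp ⊙ section D E

    reduced : P ⇝ (D ⟶ Bool)
    reduced = Λ {P} {D} {Bool} (apply (D ⊗ E) Bool ⊙ ⟨ π₁ P D , ⟨ π₂ P D , second ⟩ ⟩)

    first : P ⇝ D
    first = computes δ δ-comp ⊙ reduced

    search : P ⇝ D ⊗ E
    search = ⟨ first , second ⊙ ⟨ idᶜ , first ⟩ ⟩

    module _ (p : Map (D ⊗ E) Bool) (p-def : DefinedOn (D ⊗ E) p (K ⊠ L)) where
      q : Map D Bool
      q = map reduced · p

      p-defₓ : ∀ x → _∈_ {D} x K → DefinedOn E (slice K L p x) L
      p-defₓ = slice-defined K L p p-def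

      second∈L : ∀ x → _∈_ {D} x K → _∈_ {E} (map second · (p , x)) L
      second∈L x x∈K = proj₁ (ε-spec (slice K L p x) (p-defₓ x x∈K))

      q-def : DefinedOn D q K
      -- The point chosen by `ε` lies in `L` whether or not the slice has a solution, so no case
      -- distinction is needed.
      q-def x x∈K = p-def (x , map second · (p , x)) (x∈K , second∈L x x∈K)

      first∈K : _∈_ {D} (map first · p) K
      first∈K = proj₁ (δ-spec q q-def)

      found : _∈_ {D ⊗ E} (map search · p) (K ⊠ L)
      found = first∈K , second∈L (map first · p) first∈K

      satisfied : (∃[ z ] _∈_ {D ⊗ E} z (K ⊠ L) × p · z ≡ 1ᵇ) → p · (map search · p) ≡ 1ᵇ
      -- The goal reduces to `q · (δ · q) ≡ 1ᵇ`. The given `y` only shows that the slice at `x` is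
      -- solvable; `ε` then finds a solution, perhaps another one, and `q · x` is `1ᵇ`.
      satisfied ((x , y) , (x∈K , y∈L) , p≡1) = proj₂ (δ-spec q q-def)
        (x , x∈K , proj₂ (ε-spec (slice K L p x) (p-defₓ x x∈K)) (y , y∈L , p≡1))

  -- Finite products, by induction on the number of factors.

  ∏-exhaustible : ∀ n (D : Fin n → Domain) (K : ∀ j → Subset (D j)) →
                  (∀ j → Exhaustible (D j) (K j)) → Exhaustible (∏ D) (∏ˢ K)
  ∏-exhaustible zero          D K ex = full-exhaustible
  -- A product of one factor is that factor itself, with no `One` attached, hence a second base
  -- case.
  ∏-exhaustible (suc zero)    D K ex = ex zero
  ∏-exhaustible (suc (suc n)) D K ex = ⊠-exhaustible (K zero) (∏ˢ (K ∘ suc)) (ex zero)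
    (∏-exhaustible (suc n) (D ∘ suc) (K ∘ suc) (ex ∘ suc))

  ∏-searchable : ∀ n (D : Fin n → Domain) (K : ∀ j → Subset (D j)) →
                 (∀ j → Searchable (D j) (K j)) → Searchable (∏ D) (∏ˢ K)
  ∏-searchable zero          D K se = full-searchable
  ∏-searchable (suc zero)    D K se = se zero
  ∏-searchable (suc (suc n)) D K se = ⊠-searchable (K zero) (∏ˢ (K ∘ suc)) (se zero)
    (∏-searchable (suc n) (D ∘ suc) (K ∘ suc) (se ∘ suc))

proposition4p4 : ∀ {o : Level} (em : ExcludedMiddle 1ℓ) (𝒞 : EffectiveCCC em o) →
    let open EffectiveCCC 𝒞 in
    ∀ (n : ℕ) (D : Fin n → Domain) (K : ∀ j → Subset (D j)) →
    ((∀ j → Exhaustible (D j) (K j)) → Exhaustible (∏ D) (∏ˢ K)) ×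
    ((∀ j → Searchable (D j) (K j)) → Searchable (∏ D) (∏ˢ K))
proposition4p4 em 𝒞 n D K = ∏-exhaustible em 𝒞 n D K , ∏-searchable em 𝒞 n D K
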